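{- $\displaystyle\liminf_{k\to\infty}\frac{\gamma(k)}{k}\geq\frac12$ and $\displaystyle\limsup_{k\to\infty}\frac{\gamma(k)}{k}\geq 1$.
   Context: The Thue-Morse word is the infinite binary word ${\bf t}={\bf t}_1{\bf t}_2{\bf t}_3\cdots$, where ${\bf t}_i\in\{0,1\}$ has the same parity as the number of $1$'s in the binary expansion of $i-1$. A $k$-anti-power is a word of the form $w_1w_2\cdots w_k$ where $w_1,\ldots,w_k$ are pairwise distinct words all of the same length. Let $\mathcal F(k)$ denote the set of odd positive integers $m$ such that the prefix of ${\bf t}$ of length $km$ is a $k$-anti-power, and let $\gamma(k)=\min\mathcal F(k)$. -}

module Defs where

open import Data.Nat using (ℕ; zero; suc; _+_; _*_; _≤_; _<_)
open import Data.Nat.DivMod using (_/_; _%_)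
open import Data.List using (List; map; upTo)
open import Data.Product using (Σ; _×_)
open import Relation.Binary.PropositionalEquality using (_≡_; _≢_)

-- Number of 1's in the binary expansion of n, computed with fuel
-- (fuel ≥ number of binary digits suffices; we use fuel = n).
popcountFuel : ℕ → ℕ → ℕ
popcountFuel zero    n = 0
popcountFuel (suc f) n = n % 2 + popcountFuel f (n / 2)

popcount : ℕ → ℕ
popcount n = popcountFuel n n

-- Thue–Morse word, 0-indexed: tm n = t_{n+1} = parity of popcount n.
tm : ℕ → ℕ
tm n = popcount n % 2

block : ℕ → ℕ → List ℕ
block m j = map (λ i → tm (j * m + i)) (upTo m)

PrefixAntiPower : ℕ → ℕ → Set
PrefixAntiPower k m = ∀ i j → i < k → j < k → i ≢ j → block m i ≢ block m j

Odd : ℕ → Set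
Odd m = Σ ℕ λ r → m ≡ 1 + 2 * r

InF : ℕ → ℕ → Set
InF k m = Odd m × PrefixAntiPower k m

IsGamma : ℕ → ℕ → Set
IsGamma k g = InF k g × (∀ m → InF k m → g ≤ m)

{-# OPTIONS --safe #-}

-- Let τ be the Thue–Morse word, so τ (2^r a + c) = τ a xor τ c for c < 2^r, and let m < 2^L.  If block i of
-- length m starts in the dyadic cell X of length 2^L, then block i + 2^L starts at the same offset in cell X + m.
-- So the two blocks coincide as soon as τ agrees at X and X + m, and, if block i runs over into the next
-- cell, also at X + 1 and X + 1 + m.  For odd m > 3 with 2^L ≤ 4m and m + 3 < 2^L such an i exists with i = O(2^(L/2)):
--   * If m is not ±1 or ±3 mod 16, a bounded X satisfies both conditions.
--   * Otherwise m = 2^r q ± D with q odd, r ≥ 4 and D ∈ {1, 3}.  For r at most about L/2, both conditions hold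
--     for some X ≤ 3 · 2^r.  For larger r, an inverse of q modulo 2^(L - r + 3) gives a block that lies inside one
--     cell X, with X in a prescribed class mod 8 on which τ X = τ (X + m).
-- Hence every odd m with m + 3 < 2^L has two equal blocks with indices at most 2^L + O(2^(L/2)), so γ(k) ≥ 2^L - 3
-- once k exceeds this.  This gives the limit inferior, and k just above the bound gives the limit superior.
module Submission where

open import Defs
open import Data.Bool using (Bool; true; false; not; _xor_)
open import Data.Bool.Properties using (not-¬; not-involutive; not-distribʳ-xor; xor-identityʳ)
open import Data.Empty using (⊥)
open import Data.Fin using (Fin; toℕ; zero; suc)
open import Data.List using ([]; _∷_; map; upTo)
open import Data.List.Properties using (map-cong-local; ∷-injectiveˡ; ∷-injectiveʳ) renaming (≡-dec to List-≡-dec)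
open import Data.List.Relation.Unary.All using (All; []; _∷_)
open import Data.List.Relation.Unary.All.Properties using (applyUpTo⁺₁; applyUpTo⁻)
open import Data.Nat using (ℕ; zero; suc; _+_; _*_; _∸_; _^_; _≤_; _<_; _≥_; z≤n; s≤s; _<?_; _≤?_; ⌊_/2⌋; ⌈_/2⌉)
open import Data.Nat.DivMod
open import Data.Nat.Properties
open import Data.Nat.Tactic.RingSolver using (solve-∀)
open import Data.Product using (Σ; ∃; _×_; _,_; proj₁; proj₂)
open import Data.Sum using (_⊎_; inj₁; inj₂; [_,_]′)
open import Data.Unit using (tt)
open import Function using (id)
open import Relation.Binary.Definitions using (tri<; tri≈; tri>)
open import Relation.Binary.PropositionalEquality
open import Relation.Nullary using (¬_; Dec; yes; no; contradiction)
open import Relation.Nullary.Decidable using (True; toWitness; map′; _→-dec_; ¬?)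

-- The Thue–Morse word

parity : ℕ → Bool
parity zero    = false
parity (suc n) = not (parity n)

τ : ℕ → Bool
τ n = parity (popcount n)

bit : Bool → ℕ
bit false = 0
bit true  = 1

%2≡bit-parity : ∀ n → n % 2 ≡ bit (parity n)
%2≡bit-parity zero          = refl
%2≡bit-parity (suc zero)    = refl
%2≡bit-parity (suc (suc n)) =
  trans (%2≡bit-parity n) (cong bit (sym (not-involutive (parity n))))

tm≡bit-τ : ∀ n → tm n ≡ bit (τ n)
tm≡bit-τ n = %2≡bit-parity (popcount n)

bit-injective : ∀ {a b} → bit a ≡ bit b → a ≡ b
bit-injective {false} {false} _ = refl
bit-injective {true}  {true}  _ = refl

popcountFuel-zero : ∀ f → popcountFuel f 0 ≡ 0
popcountFuel-zero zero    = refl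
popcountFuel-zero (suc f) = popcountFuel-zero f

suc-/2≤ : ∀ {n f} → suc n ≤ suc f → suc n / 2 ≤ f
suc-/2≤ {n} n≤f = ≤-pred (≤-trans (m/n<m (suc n) 2 (s≤s (s≤s z≤n))) n≤f)

-- Unfolding `popcount (suc n)` leaves `n` units of fuel for `suc n / 2`, usually more than
-- `popcount` itself would use. Halving a positive number strictly decreases it, so surplus fuel
-- only adds zeros.
popcountFuel-enough : ∀ f g n → n ≤ f → n ≤ g → popcountFuel f n ≡ popcountFuel g n
popcountFuel-enough f g zero _ _ = trans (popcountFuel-zero f) (sym (popcountFuel-zero g))
popcountFuel-enough (suc f) (suc g) (suc n) n≤f n≤g =
  cong (suc n % 2 +_) (popcountFuel-enough f g (suc n / 2) (suc-/2≤ n≤f) (suc-/2≤ n≤g))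

popcount-step : ∀ n → popcount n ≡ n % 2 + popcount (n / 2)
popcount-step zero    = refl
popcount-step (suc n) =
  cong (suc n % 2 +_) (popcountFuel-enough n (suc n / 2) (suc n / 2) (suc-/2≤ {n} {n} ≤-refl) ≤-refl)

τ-double : ∀ n → τ (2 * n) ≡ τ n
τ-double n = cong parity (begin
  popcount (2 * n)                             ≡⟨ popcount-step (2 * n) ⟩
  (2 * n) % 2 + popcount ((2 * n) / 2)         ≡⟨ cong₂ (λ a b → a + popcount b) eq% eq/ ⟩
  popcount n                                   ∎)
  where
  open ≡-Reasoning
  eq% : (2 * n) % 2 ≡ 0
  eq% = trans (cong (_% 2) (*-comm 2 n)) (m*n%n≡0 n 2)
  eq/ : (2 * n) / 2 ≡ n
  eq/ = trans (cong (_/ 2) (*-comm 2 n)) (m*n/n≡m n 2)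

τ-suc-double : ∀ n → τ (1 + 2 * n) ≡ not (τ n)
τ-suc-double n = cong parity (begin
  popcount (1 + 2 * n)                             ≡⟨ popcount-step (1 + 2 * n) ⟩
  (1 + 2 * n) % 2 + popcount ((1 + 2 * n) / 2)     ≡⟨ cong₂ (λ a b → a + popcount b) eq% eq/ ⟩
  suc (popcount n)                                 ∎)
  where
  open ≡-Reasoning
  eq% : (1 + 2 * n) % 2 ≡ 1
  eq% = trans (cong (λ k → (1 + k) % 2) (*-comm 2 n)) ([m+kn]%n≡m%n 1 n 2)
  eq/ : (1 + 2 * n) / 2 ≡ n
  eq/ = trans (cong (λ k → (1 + k) / 2) (*-comm 2 n))
          (trans (+-distrib-/ 1 (n * 2) (subst (λ k → 1 + k < 2) (sym (m*n%n≡0 n 2)) ≤-refl)) (m*n/n≡m n 2))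

halve : ∀ n → ∃ λ h → n ≡ 2 * h ⊎ n ≡ 1 + 2 * h
halve zero = 0 , inj₁ refl
halve (suc n) with halve n
... | h , inj₁ eq = h , inj₂ (cong suc eq)
... | h , inj₂ eq = suc h , inj₁ (trans (cong suc eq) (sym (*-suc 2 h)))

τ-concat : ∀ r a c → c < 2 ^ r → τ (2 ^ r * a + c) ≡ τ a xor τ c
τ-concat zero a zero _ =
  trans (cong τ (trans (+-identityʳ (1 * a)) (*-identityˡ a))) (sym (xor-identityʳ (τ a)))
τ-concat zero a (suc c) (s≤s ())
τ-concat (suc r) a c c< with halve c
... | h , inj₁ refl = begin
  τ (2 * 2 ^ r * a + 2 * h)      ≡⟨ cong τ (lem (2 ^ r) a h) ⟩
  τ (2 * (2 ^ r * a + h))        ≡⟨ τ-double (2 ^ r * a + h) ⟩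
  τ (2 ^ r * a + h)              ≡⟨ τ-concat r a h (*-cancelˡ-< 2 h (2 ^ r) c<) ⟩
  τ a xor τ h                    ≡⟨ cong (τ a xor_) (τ-double h) ⟨
  τ a xor τ (2 * h)              ∎
  where
  open ≡-Reasoning
  lem : ∀ p a h → 2 * p * a + 2 * h ≡ 2 * (p * a + h)
  lem = solve-∀
... | h , inj₂ refl = begin
  τ (2 * 2 ^ r * a + (1 + 2 * h)) ≡⟨ cong τ (lem (2 ^ r) a h) ⟩
  τ (1 + 2 * (2 ^ r * a + h))     ≡⟨ τ-suc-double (2 ^ r * a + h) ⟩
  not (τ (2 ^ r * a + h))         ≡⟨ cong not (τ-concat r a h (*-cancelˡ-< 2 h (2 ^ r) (<-trans ≤-refl c<))) ⟩
  not (τ a xor τ h)               ≡⟨ not-distribʳ-xor (τ a) (τ h) ⟩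
  τ a xor not (τ h)               ≡⟨ cong (τ a xor_) (τ-suc-double h) ⟨
  τ a xor τ (1 + 2 * h)           ∎
  where
  open ≡-Reasoning
  lem : ∀ p a h → 2 * p * a + (1 + 2 * h) ≡ 1 + 2 * (p * a + h)
  lem = solve-∀

map-pointwise : ∀ {A B : Set} {f g : A → B} xs → map f xs ≡ map g xs → All (λ x → f x ≡ g x) xs
map-pointwise []       _  = []
map-pointwise (x ∷ xs) eq = ∷-injectiveˡ eq ∷ map-pointwise xs (∷-injectiveʳ eq)

block-cong : ∀ m i j → (∀ {p} → p < m → τ (i * m + p) ≡ τ (j * m + p)) → block m i ≡ block m j
block-cong m i j eq = map-cong-local (applyUpTo⁺₁ id m λ {p} p<m →
  trans (tm≡bit-τ (i * m + p)) (trans (cong bit (eq p<m)) (sym (tm≡bit-τ (j * m + p)))))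

block-pointwise : ∀ m i j → block m i ≡ block m j → ∀ {p} → p < m → τ (i * m + p) ≡ τ (j * m + p)
block-pointwise m i j eq {p} p<m = bit-injective
  (trans (sym (tm≡bit-τ (i * m + p)))
    (trans (applyUpTo⁻ id m (map-pointwise (upTo m) eq) p<m) (tm≡bit-τ (j * m + p))))

-- Blocks and dyadic cells

module _ (L m i X y : ℕ) (start : i * m ≡ 2 ^ L * X + y) where

  private
    start+ : ∀ p → i * m + p ≡ 2 ^ L * X + (y + p)
    start+ p = trans (cong (_+ p) start) (+-assoc (2 ^ L * X) y p)

    shifted+ : ∀ p → (i + 2 ^ L) * m + p ≡ 2 ^ L * (X + m) + (y + p)
    shifted+ p = trans (lem i (2 ^ L) m p) (trans (cong (_+ 2 ^ L * m) (start+ p)) (lem′ (2 ^ L) X m (y + p)))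
      where
      lem : ∀ i P m p → (i + P) * m + p ≡ (i * m + p) + P * m
      lem = solve-∀
      lem′ : ∀ P X m c → (P * X + c) + P * m ≡ P * (X + m) + c
      lem′ = solve-∀

    agree-in-first : τ X ≡ τ (X + m) → ∀ {p} → y + p < 2 ^ L →
      τ (i * m + p) ≡ τ ((i + 2 ^ L) * m + p)
    agree-in-first eq {p} c< = begin
      τ (i * m + p)                  ≡⟨ cong τ (start+ p) ⟩
      τ (2 ^ L * X + (y + p))        ≡⟨ τ-concat L X (y + p) c< ⟩
      τ X xor τ (y + p)              ≡⟨ cong (_xor τ (y + p)) eq ⟩
      τ (X + m) xor τ (y + p)        ≡⟨ τ-concat L (X + m) (y + p) c< ⟨
      τ (2 ^ L * (X + m) + (y + p))  ≡⟨ cong τ (shifted+ p) ⟨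
      τ ((i + 2 ^ L) * m + p)        ∎
      where open ≡-Reasoning

    agree-in-second : τ (suc X) ≡ τ (suc X + m) → ∀ {p c} → y + p ≡ 2 ^ L + c → c < 2 ^ L →
      τ (i * m + p) ≡ τ ((i + 2 ^ L) * m + p)
    agree-in-second eq {p} {c} y+p c< = begin
      τ (i * m + p)                  ≡⟨ cong τ (trans (start+ p) (carry X)) ⟩
      τ (2 ^ L * suc X + c)          ≡⟨ τ-concat L (suc X) c c< ⟩
      τ (suc X) xor τ c              ≡⟨ cong (_xor τ c) eq ⟩
      τ (suc X + m) xor τ c          ≡⟨ τ-concat L (suc X + m) c c< ⟨
      τ (2 ^ L * (suc X + m) + c)    ≡⟨ cong τ (trans (shifted+ p) (carry (X + m))) ⟨
      τ ((i + 2 ^ L) * m + p)        ∎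
      where
      open ≡-Reasoning
      lem : ∀ P Z c → P * Z + (P + c) ≡ P * (1 + Z) + c
      lem = solve-∀
      carry : ∀ Z → 2 ^ L * Z + (y + p) ≡ 2 ^ L * suc Z + c
      carry Z = trans (cong (2 ^ L * Z +_) y+p) (lem (2 ^ L) Z c)

  one-cell-collision : y + m ≤ 2 ^ L → τ X ≡ τ (X + m) → block m i ≡ block m (i + 2 ^ L)
  one-cell-collision fits eq = block-cong m i (i + 2 ^ L) λ p<m →
    agree-in-first eq (<-≤-trans (+-monoʳ-< y p<m) fits)

  two-cell-collision : y < 2 ^ L → m ≤ 2 ^ L → τ X ≡ τ (X + m) → τ (suc X) ≡ τ (suc X + m) →
    block m i ≡ block m (i + 2 ^ L)
  two-cell-collision y< m≤ eq₀ eq₁ = block-cong m i (i + 2 ^ L) agree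
    where
    agree : ∀ {p} → p < m → τ (i * m + p) ≡ τ ((i + 2 ^ L) * m + p)
    agree {p} p<m with y + p <? 2 ^ L
    ... | yes c< = agree-in-first eq₀ c<
    ... | no c≮ = agree-in-second eq₁ (sym (m+[n∸m]≡n c≥))
            (+-cancelˡ-< (2 ^ L) _ _ (subst (_< 2 ^ L + 2 ^ L) (sym (m+[n∸m]≡n c≥)) (+-mono-< y< (<-≤-trans p<m m≤))))
      where
      c≥ : 2 ^ L ≤ y + p
      c≥ = ≮⇒≥ c≮

-- i * m is the first multiple of m strictly beyond the start of cell X; as m < 2 ^ L it still lies in that cell.
two-cell-collision-near : ∀ L m X → 0 < m → m < 2 ^ L → 2 ^ L ≤ 4 * m →
  τ X ≡ τ (X + m) → τ (suc X) ≡ τ (suc X + m) →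
  ∃ λ i → i ≤ suc (4 * X) × block m i ≡ block m (i + 2 ^ L)
two-cell-collision-near L m@(suc _) X _ m<P P≤4m eq₀ eq₁ =
  i , s≤s N/m≤4X , two-cell-collision L m i X y start (≤-<-trans (m∸n≤m m (N % m)) m<P) (<⇒≤ m<P) eq₀ eq₁
  where
  N i y : ℕ
  N = 2 ^ L * X
  i = suc (N / m)
  y = m ∸ N % m
  start : i * m ≡ N + y
  start = begin
    m + N / m * m                        ≡⟨ cong (_+ N / m * m) (m+[n∸m]≡n (<⇒≤ (m%n<n N m))) ⟨
    N % m + y + N / m * m                ≡⟨ lem (N % m) y (N / m * m) ⟩
    N % m + N / m * m + y                ≡⟨ cong (_+ y) (m≡m%n+[m/n]*n N m) ⟨
    N + y                                ∎
    where
    open ≡-Reasoning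
    lem : ∀ a b c → a + b + c ≡ a + c + b
    lem = solve-∀
  N/m≤4X : N / m ≤ 4 * X
  N/m≤4X = ≤-trans (/-monoˡ-≤ m (≤-trans (*-monoˡ-≤ X P≤4m) (≤-reflexive (lem m X)))) (≤-reflexive (m*n/n≡m (4 * X) m))
    where
    lem : ∀ m X → 4 * m * X ≡ 4 * X * m
    lem = solve-∀

-- Adding m to a cell index without carries

xor-swap-≡ : ∀ a b c d → a xor b ≡ c xor d → c xor a ≡ d xor b
xor-swap-≡ false false false false _ = refl
xor-swap-≡ false false true true _ = refl
xor-swap-≡ false true false true _ = refl
xor-swap-≡ false true true false _ = refl
xor-swap-≡ true false false true _ = refl
xor-swap-≡ true false true false _ = refl
xor-swap-≡ true true false false _ = refl
xor-swap-≡ true true true true _ = refl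

-- Taking `e` or `d` to be 0 writes m = 2^r q ± D without subtraction. The bounds rule out carries:
-- X = 2^r y + (z + e) and X + m = 2^r (q + y) + (z + d) both split at digit `r`, and the last
-- hypothesis says that the change of τ in the low part cancels that in the high part.
τ-shift-agree : ∀ r q m d e y z → m + e ≡ 2 ^ r * q + d → z + e < 2 ^ r → z + d < 2 ^ r →
  τ (z + e) xor τ (z + d) ≡ τ y xor τ (q + y) →
  τ (2 ^ r * y + (z + e)) ≡ τ (2 ^ r * y + (z + e) + m)
τ-shift-agree r q m d e y z m+e ze< zd< eq = begin
  τ (2 ^ r * y + (z + e))         ≡⟨ τ-concat r y (z + e) ze< ⟩
  τ y xor τ (z + e)               ≡⟨ xor-swap-≡ (τ (z + e)) (τ (z + d)) (τ y) (τ (q + y)) eq ⟩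
  τ (q + y) xor τ (z + d)         ≡⟨ τ-concat r (q + y) (z + d) zd< ⟨
  τ (2 ^ r * (q + y) + (z + d))   ≡⟨ cong τ (lem′ (2 ^ r) q y z d) ⟩
  τ (2 ^ r * y + z + (2 ^ r * q + d)) ≡⟨ cong (λ k → τ (2 ^ r * y + z + k)) m+e ⟨
  τ (2 ^ r * y + z + (m + e))     ≡⟨ cong τ (lem (2 ^ r * y) z m e) ⟩
  τ (2 ^ r * y + (z + e) + m)     ∎
  where
  open ≡-Reasoning
  lem : ∀ A z m e → A + z + (m + e) ≡ A + (z + e) + m
  lem = solve-∀
  lem′ : ∀ P q y z d → P * (q + y) + (z + d) ≡ P * y + z + (P * q + d)
  lem′ = solve-∀

-- τ 1 and τ 2 are both true, whereas for q = 1 + 2p the numbers q + 1 = 2(p + 1) and q + 2 = 2(p +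
-- 1) + 1 differ only in the last digit. Hence y = 1 and y = 2 give opposite values.
odd-both-signs : ∀ p c → ∃ λ y → y ≤ 2 × τ y xor τ ((1 + 2 * p) + y) ≡ c
odd-both-signs p c = go (τ (suc p)) c refl
  where
  τ-plus-1 : τ ((1 + 2 * p) + 1) ≡ τ (suc p)
  τ-plus-1 = trans (cong τ (lem p)) (τ-double (suc p))
    where
    lem : ∀ p → (1 + 2 * p) + 1 ≡ 2 * (1 + p)
    lem = solve-∀
  τ-plus-2 : τ ((1 + 2 * p) + 2) ≡ not (τ (suc p))
  τ-plus-2 = trans (cong τ (lem p)) (τ-suc-double (suc p))
    where
    lem : ∀ p → (1 + 2 * p) + 2 ≡ 1 + 2 * (1 + p)
    lem = solve-∀
  go : ∀ b c → τ (suc p) ≡ b → ∃ λ y → y ≤ 2 × τ y xor τ ((1 + 2 * p) + y) ≡ c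
  go false false eq = 2 , ≤-refl , cong not (trans τ-plus-2 (cong not eq))
  go false true  eq = 1 , s≤s z≤n , cong not (trans τ-plus-1 eq)
  go true  false eq = 1 , s≤s z≤n , cong not (trans τ-plus-1 eq)
  go true  true  eq = 2 , ≤-refl , cong not (trans τ-plus-2 (cong not eq))

-- Lengths close to a multiple of a large power of two

-- Lifting by one binary digit at a time: replacing `i` by `i + 2 ^ N` adds the odd number
-- `1 + 2 * p` to the quotient, so one of the two choices gives the quotient the parity of digit `N`
-- of `T`. The quotient `s` is returned because it becomes the high part of a cell index.
odd-solve-mod-2^ : ∀ p N T → T < 2 ^ N → ∃ λ i → i < 2 ^ N × ∃ λ s → i * (1 + 2 * p) ≡ T + 2 ^ N * s
odd-solve-mod-2^ p zero zero _ = 0 , s≤s z≤n , 0 , refl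
odd-solve-mod-2^ p zero (suc T) (s≤s ())
odd-solve-mod-2^ p (suc N) T T< with T <? 2 ^ N
... | yes T<P = lift (odd-solve-mod-2^ p N T T<P)
  where
  lift : (∃ λ i → i < 2 ^ N × ∃ λ s → i * (1 + 2 * p) ≡ T + 2 ^ N * s) →
         ∃ λ i → i < 2 ^ suc N × ∃ λ s → i * (1 + 2 * p) ≡ T + 2 ^ suc N * s
  lift (i , i< , s , eq) with halve s
  ... | h , inj₁ refl = i , <-≤-trans i< (m≤m+n (2 ^ N) _) , h , trans eq (lem T (2 ^ N) h)
    where
    lem : ∀ T P h → T + P * (2 * h) ≡ T + 2 * P * h
    lem = solve-∀
  ... | h , inj₂ refl = i + 2 ^ N , subst (i + 2 ^ N <_) (lem₂ (2 ^ N)) (+-monoˡ-< (2 ^ N) i<) , 1 + h + p ,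
        trans (lem₁ i (2 ^ N) p) (trans (cong (_+ 2 ^ N * (1 + 2 * p)) eq) (lem T (2 ^ N) h p))
    where
    lem₁ : ∀ i P p → (i + P) * (1 + 2 * p) ≡ i * (1 + 2 * p) + P * (1 + 2 * p)
    lem₁ = solve-∀
    lem : ∀ T P h p → T + P * (1 + 2 * h) + P * (1 + 2 * p) ≡ T + 2 * P * (1 + h + p)
    lem = solve-∀
    lem₂ : ∀ P → P + P ≡ 2 * P
    lem₂ = solve-∀
... | no T≮P = lift (odd-solve-mod-2^ p N (T ∸ 2 ^ N) T′<)
  where
  T≡ : 2 ^ N + (T ∸ 2 ^ N) ≡ T
  T≡ = m+[n∸m]≡n (≮⇒≥ T≮P)
  T′< : T ∸ 2 ^ N < 2 ^ N
  T′< = +-cancelˡ-< (2 ^ N) _ _ (subst₂ _<_ (sym T≡) (cong (2 ^ N +_) (+-identityʳ (2 ^ N))) T<)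
  lift : (∃ λ i → i < 2 ^ N × ∃ λ s → i * (1 + 2 * p) ≡ T ∸ 2 ^ N + 2 ^ N * s) →
         ∃ λ i → i < 2 ^ suc N × ∃ λ s → i * (1 + 2 * p) ≡ T + 2 ^ suc N * s
  lift (i , i< , s , eq) with halve s
  ... | h , inj₂ refl = i , <-≤-trans i< (m≤m+n (2 ^ N) _) , h ,
        trans eq (trans (lem (T ∸ 2 ^ N) (2 ^ N) h) (cong (_+ 2 ^ suc N * h) T≡))
    where
    lem : ∀ T P h → T + P * (1 + 2 * h) ≡ P + T + 2 * P * h
    lem = solve-∀
  ... | h , inj₁ refl = i + 2 ^ N , subst (i + 2 ^ N <_) (lem₂ (2 ^ N)) (+-monoˡ-< (2 ^ N) i<) , h + p ,
        trans (lem₁ i (2 ^ N) p) (trans (cong (_+ 2 ^ N * (1 + 2 * p)) eq)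
          (trans (lem (T ∸ 2 ^ N) (2 ^ N) h p) (cong (_+ 2 ^ suc N * (h + p)) T≡)))
    where
    lem₁ : ∀ i P p → (i + P) * (1 + 2 * p) ≡ i * (1 + 2 * p) + P * (1 + 2 * p)
    lem₁ = solve-∀
    lem : ∀ T P h p → T + P * (2 * h) + P * (1 + 2 * p) ≡ P + T + 2 * P * (h + p)
    lem = solve-∀
    lem₂ : ∀ P → P + P ≡ 2 * P
    lem₂ = solve-∀

dyadic : ∀ n → 0 < n → ∃ λ s → ∃ λ p → n ≡ 2 ^ s * (1 + 2 * p)
dyadic n = go n n ≤-refl
  where
  go : ∀ b n → n ≤ b → 0 < n → ∃ λ s → ∃ λ p → n ≡ 2 ^ s * (1 + 2 * p)
  go zero zero _ ()
  go (suc b) n n≤b 0<n with halve n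
  ... | p , inj₂ eq = 0 , p , trans eq (sym (*-identityˡ (1 + 2 * p)))
  ... | suc h , inj₁ refl with go b (suc h) (≤-pred (≤-trans (m<m+n (suc h) (s≤s z≤n)) n≤b)) (s≤s z≤n)
  ... | s , p , eq = suc s , p , trans (cong (2 *_) eq) (sym (*-assoc 2 (2 ^ s) (1 + 2 * p)))

2^-cancel-< : ∀ {a b} → 2 ^ a < 2 ^ b → a < b
2^-cancel-< {a} {b} lt = ≰⇒> λ b≤a → <⇒≱ lt (^-monoʳ-≤ 2 b≤a)

double-cancel-≤ : ∀ {a b} → a + a ≤ b + b → a ≤ b
double-cancel-≤ {a} {b} le = ≮⇒≥ λ b<a → <⇒≱ (+-mono-< b<a b<a) le

-- `c` will be ⌈L/2⌉, and the 10 absorbs the constants of all cases. Keeping `c` apart from `L`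
-- leaves the error term fixed when `repetition-below` descends on `L`.
Collision : ℕ → ℕ → ℕ → Set
Collision c L m = ∃ λ i → i ≤ 2 ^ (c + 10) × block m i ≡ block m (i + 2 ^ L)

-- The slack 3 in `m+3<` covers rounding m up by `e`, so that 2^r q < 2^L and hence q < 2^a below.
module NearDyadic
  (c L m r p d e : ℕ)
  (m+e : m + e ≡ 2 ^ r * (1 + 2 * p) + d) (4≤r : 4 ≤ r) (d≤3 : d ≤ 3) (e≤3 : e ≤ 3)
  (e≡0⊎d≡0 : e ≡ 0 ⊎ d ≡ 0)
  (0<m : 0 < m) (m+3< : m + 3 < 2 ^ L) (P≤4m : 2 ^ L ≤ 4 * m) (L≤2c : L ≤ c + c)
  where

  private
    q : ℕ
    q = 1 + 2 * p

    m<P : m < 2 ^ L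
    m<P = ≤-<-trans (m≤m+n m 3) m+3<

    2^rq<2^L : 2 ^ r * q < 2 ^ L
    2^rq<2^L = ≤-<-trans (m≤m+n _ d) (subst (_< 2 ^ L) m+e (≤-<-trans (+-monoʳ-≤ m e≤3) m+3<))

    r<L : r < L
    r<L = 2^-cancel-< (≤-<-trans (m≤m*n (2 ^ r) q) 2^rq<2^L)

    a : ℕ
    a = L ∸ r

    r+a : r + a ≡ L
    r+a = m+[n∸m]≡n (<⇒≤ r<L)

    2^L≡ : 2 ^ L ≡ 2 ^ r * 2 ^ a
    2^L≡ = trans (cong (2 ^_) (sym r+a)) (^-distribˡ-+-* 2 r a)

    q<2^a : q < 2 ^ a
    q<2^a = *-cancelˡ-< (2 ^ r) q (2 ^ a) (subst (2 ^ r * q <_) 2^L≡ 2^rq<2^L)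

  -- X and X + 1 have the same high part y, so a single y from `odd-both-signs` serves both once the
  -- low parts at z and z + 1 have equal signs. With r + a = L ≤ 2c, the bound on `r` gives r ≤ c +
  -- 2, so X < 3 * 2^r stays within O(2^c).
  collision-small-r : (∃ λ z → z ≤ 11 × τ (z + e) xor τ (z + d) ≡ τ (suc z + e) xor τ (suc z + d)) →
    r ≤ a + 4 → Collision c L m
  collision-small-r (z , z≤11 , same) r≤a+4 = bounded
    (two-cell-collision-near L m X 0<m m<P P≤4m
      (τ-shift-agree r q m d e y z m+e (small z≤11 e≤3) (small z≤11 d≤3) (sym sign))
      (subst (λ k → τ k ≡ τ (k + m)) (+-suc (2 ^ r * y) (z + e))
        (τ-shift-agree r q m d e y (suc z) m+e (small′ z≤11 e≤3) (small′ z≤11 d≤3) (trans (sym same) (sym sign)))))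
    where
    y : ℕ
    y = proj₁ (odd-both-signs p (τ (z + e) xor τ (z + d)))
    y≤2 : y ≤ 2
    y≤2 = proj₁ (proj₂ (odd-both-signs p (τ (z + e) xor τ (z + d))))
    sign : τ y xor τ (q + y) ≡ τ (z + e) xor τ (z + d)
    sign = proj₂ (proj₂ (odd-both-signs p (τ (z + e) xor τ (z + d))))
    X : ℕ
    X = 2 ^ r * y + (z + e)
    -- The largest low part that occurs is 11 + 1 + 3 = 15, which is why z ≤ 11 is asked for.
    16≤2^r : 16 ≤ 2 ^ r
    16≤2^r = ^-monoʳ-≤ 2 4≤r
    small : ∀ {z e} → z ≤ 11 → e ≤ 3 → z + e < 2 ^ r
    small z≤ e≤ = ≤-trans (s≤s (≤-trans (+-mono-≤ z≤ e≤) (n≤1+n 14))) 16≤2^r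
    small′ : ∀ {z e} → z ≤ 11 → e ≤ 3 → suc z + e < 2 ^ r
    small′ z≤ e≤ = ≤-trans (s≤s (s≤s (+-mono-≤ z≤ e≤))) 16≤2^r
    r≤c+2 : r ≤ c + 2
    r≤c+2 = double-cancel-≤ (begin
      r + r             ≤⟨ +-monoʳ-≤ r r≤a+4 ⟩
      r + (a + 4)       ≡⟨ +-assoc r a 4 ⟨
      r + a + 4         ≡⟨ cong (_+ 4) r+a ⟩
      L + 4             ≤⟨ +-monoˡ-≤ 4 L≤2c ⟩
      c + c + 4         ≡⟨ lem c ⟩
      (c + 2) + (c + 2) ∎)
      where
      open ≤-Reasoning
      lem : ∀ c → c + c + 4 ≡ (c + 2) + (c + 2)
      lem = solve-∀
    X≤ : X ≤ 2 ^ r * 2 + 2 ^ r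
    X≤ = +-mono-≤ (*-monoʳ-≤ (2 ^ r) y≤2) (<⇒≤ (small z≤11 e≤3))
    X-bound : suc (4 * X) ≤ 2 ^ (c + 10)
    X-bound = begin
      suc (4 * X)                              ≤⟨ +-mono-≤ (m^n>0 2 r) (*-monoʳ-≤ 4 X≤) ⟩
      2 ^ r + 4 * (2 ^ r * 2 + 2 ^ r)          ≡⟨ lem (2 ^ r) ⟩
      2 ^ r * 13                               ≤⟨ *-monoʳ-≤ (2 ^ r) (toWitness {a? = 13 ≤? 16} tt) ⟩
      2 ^ r * 2 ^ 4                            ≡⟨ ^-distribˡ-+-* 2 r 4 ⟨
      2 ^ (r + 4)                              ≤⟨ ^-monoʳ-≤ 2 (+-monoˡ-≤ 4 r≤c+2) ⟩
      2 ^ (c + 2 + 4)                          ≡⟨ cong (2 ^_) (+-assoc c 2 4) ⟩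
      2 ^ (c + 6)                              ≤⟨ ^-monoʳ-≤ 2 (+-monoʳ-≤ c (toWitness {a? = 6 ≤? 10} tt)) ⟩
      2 ^ (c + 10)                             ∎
      where
      open ≤-Reasoning
      lem : ∀ P → P + 4 * (P * 2 + P) ≡ P * 13
      lem = solve-∀
    bounded : (∃ λ i → i ≤ suc (4 * X) × block m i ≡ block m (i + 2 ^ L)) → Collision c L m
    bounded (i , i≤ , eq) = i , ≤-trans i≤ X-bound , eq

  private
    -- The start i * m will have offset 2 ^ r * ε + i * d - i * e in its cell: ε = 1 makes this nonnegative
    -- when d = 0, and ε = 0 keeps the whole block inside the cell when e = 0.
    rounding : ∃ λ ε → ε ≤ 1 × (ε ≡ 0 × e ≡ 0 ⊎ ε ≡ 1 × d ≡ 0)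
    rounding = [ (λ e≡0 → 0 , z≤n , inj₁ (refl , e≡0)) , (λ d≡0 → 1 , ≤-refl , inj₂ (refl , d≡0)) ]′ e≡0⊎d≡0

    -- Each block drifts by d - e against the multiples of 2^r q. After `i` blocks the drift is
    -- still below 2^r, as 3(i + 1) ≤ 2^(a + 5) ≤ 2^r, and q + 1 ≤ 2^a leaves one spare unit 2^r in
    -- the cell to hold it.
    offset : ∀ i ε → a + 5 ≤ r → i < 2 ^ (a + 3) → (ε ≡ 0 × e ≡ 0 ⊎ ε ≡ 1 × d ≡ 0) →
      ∃ λ y → 2 ^ r * ε + i * d ≡ y + i * e × y + m ≤ 2 ^ L
    offset i ε a+5≤r i< cases = go cases
      where
      [1+i]*3≤2^r : suc i * 3 ≤ 2 ^ r
      [1+i]*3≤2^r = begin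
        suc i * 3             ≤⟨ *-mono-≤ i< (n≤1+n 3) ⟩
        2 ^ (a + 3) * 2 ^ 2   ≡⟨ ^-distribˡ-+-* 2 (a + 3) 2 ⟨
        2 ^ (a + 3 + 2)       ≡⟨ cong (2 ^_) (+-assoc a 3 2) ⟩
        2 ^ (a + 5)           ≤⟨ ^-monoʳ-≤ 2 a+5≤r ⟩
        2 ^ r                 ∎
        where open ≤-Reasoning
      go : (ε ≡ 0 × e ≡ 0 ⊎ ε ≡ 1 × d ≡ 0) → ∃ λ y → 2 ^ r * ε + i * d ≡ y + i * e × y + m ≤ 2 ^ L
      go (inj₁ (refl , refl)) = i * d , lem (2 ^ r) (i * d) i , (begin
        i * d + m                     ≡⟨ cong (i * d +_) (trans (sym (+-identityʳ m)) m+e) ⟩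
        i * d + (2 ^ r * q + d)       ≡⟨ lem₂ i d (2 ^ r * q) ⟩
        suc i * d + 2 ^ r * q         ≤⟨ +-monoˡ-≤ (2 ^ r * q) (≤-trans (*-monoʳ-≤ (suc i) d≤3) [1+i]*3≤2^r) ⟩
        2 ^ r + 2 ^ r * q             ≡⟨ *-suc (2 ^ r) q ⟨
        2 ^ r * suc q                 ≤⟨ *-monoʳ-≤ (2 ^ r) q<2^a ⟩
        2 ^ r * 2 ^ a                 ≡⟨ 2^L≡ ⟨
        2 ^ L                         ∎)
        where
        open ≤-Reasoning
        lem : ∀ P x i → P * 0 + x ≡ x + i * 0
        lem = solve-∀
        lem₂ : ∀ i d Q → i * d + (Q + d) ≡ (1 + i) * d + Q
        lem₂ = solve-∀
      go (inj₂ (refl , refl)) = 2 ^ r ∸ i * e , eq , (begin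
        2 ^ r ∸ i * e + m             ≤⟨ +-mono-≤ (m∸n≤m (2 ^ r) (i * e)) (m≤m+n m e) ⟩
        2 ^ r + (m + e)               ≡⟨ cong (2 ^ r +_) (trans m+e (+-identityʳ (2 ^ r * q))) ⟩
        2 ^ r + 2 ^ r * q             ≡⟨ *-suc (2 ^ r) q ⟨
        2 ^ r * suc q                 ≤⟨ *-monoʳ-≤ (2 ^ r) q<2^a ⟩
        2 ^ r * 2 ^ a                 ≡⟨ 2^L≡ ⟨
        2 ^ L                         ∎)
        where
        open ≤-Reasoning
        lem : ∀ P i → P * 1 + i * 0 ≡ P
        lem = solve-∀
        eq : 2 ^ r * 1 + i * 0 ≡ 2 ^ r ∸ i * e + i * e
        eq = trans (lem (2 ^ r) i) (sym (m∸n+n≡m (≤-trans (*-mono-≤ (n≤1+n i) e≤3) [1+i]*3≤2^r)))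

  -- Solving i q = 2^a (ρ + e) + ε modulo 2^(a + 3) gives i q = 2^a X + ε with X = 8s + ρ + e: the
  -- three extra digits prescribe X mod 8, and multiplying by 2^r puts i m in cell X. Here X is so
  -- small that its high part above 2^r is 0, so the sign to be met is τ q, and `ρ` is chosen to
  -- meet it.
  collision-large-r : (∀ b → ∃ λ ρ → ρ ≤ 2 × τ (ρ + e) xor τ (ρ + d) ≡ b) →
    a + 5 ≤ r → Collision c L m
  collision-large-r choose a+5≤r = i , i≤ , one-cell-collision L m i X y start (proj₂ (proj₂ off)) agree
    where
    ρ ε : ℕ
    ρ = proj₁ (choose (τ q))
    ρ≤2 : ρ ≤ 2
    ρ≤2 = proj₁ (proj₂ (choose (τ q)))
    sign : τ (ρ + e) xor τ (ρ + d) ≡ τ q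
    sign = proj₂ (proj₂ (choose (τ q)))
    ε = proj₁ rounding
    ε≤2^a : ε ≤ 2 ^ a
    ε≤2^a = ≤-trans (proj₁ (proj₂ rounding)) (m^n>0 2 a)
    T< : 2 ^ a * (ρ + e) + ε < 2 ^ (a + 3)
    T< = begin-strict
      2 ^ a * (ρ + e) + ε    ≤⟨ +-mono-≤ (*-monoʳ-≤ (2 ^ a) (+-mono-≤ ρ≤2 e≤3)) ε≤2^a ⟩
      2 ^ a * 5 + 2 ^ a      ≡⟨ lem (2 ^ a) ⟩
      2 ^ a * 6              <⟨ *-monoʳ-< (2 ^ a) {{m^n≢0 2 a}} (toWitness {a? = 7 ≤? 8} tt) ⟩
      2 ^ a * 2 ^ 3          ≡⟨ ^-distribˡ-+-* 2 a 3 ⟨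
      2 ^ (a + 3)            ∎
      where
      open ≤-Reasoning
      lem : ∀ A → A * 5 + A ≡ A * 6
      lem = solve-∀
    sol : ∃ λ i → i < 2 ^ (a + 3) × ∃ λ s → i * q ≡ (2 ^ a * (ρ + e) + ε) + 2 ^ (a + 3) * s
    sol = odd-solve-mod-2^ p (a + 3) (2 ^ a * (ρ + e) + ε) T<
    i s z X : ℕ
    i = proj₁ sol
    s = proj₁ (proj₂ (proj₂ sol))
    z = 8 * s + ρ
    X = z + e
    i< : i < 2 ^ (a + 3)
    i< = proj₁ (proj₂ sol)
    iq : i * q ≡ 2 ^ a * X + ε
    iq = trans (proj₂ (proj₂ (proj₂ sol)))
      (trans (cong (λ k → (2 ^ a * (ρ + e) + ε) + k * s) (^-distribˡ-+-* 2 a 3)) (lem (2 ^ a) ρ e ε s))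
      where
      lem : ∀ A ρ e ε s → (A * (ρ + e) + ε) + A * 8 * s ≡ A * (8 * s + ρ + e) + ε
      lem = solve-∀
    off : ∃ λ y → 2 ^ r * ε + i * d ≡ y + i * e × y + m ≤ 2 ^ L
    off = offset i ε a+5≤r i< (proj₂ (proj₂ rounding))
    y : ℕ
    y = proj₁ off
    start : i * m ≡ 2 ^ L * X + y
    start = +-cancelʳ-≡ (i * e) _ _ (begin
      i * m + i * e                             ≡⟨ *-distribˡ-+ i m e ⟨
      i * (m + e)                               ≡⟨ cong (i *_) m+e ⟩
      i * (2 ^ r * q + d)                       ≡⟨ lem₁ i (2 ^ r) q d ⟩
      2 ^ r * (i * q) + i * d                   ≡⟨ cong (λ k → 2 ^ r * k + i * d) iq ⟩
      2 ^ r * (2 ^ a * X + ε) + i * d           ≡⟨ lem₂ (2 ^ r) (2 ^ a) X ε (i * d) ⟩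
      2 ^ r * 2 ^ a * X + (2 ^ r * ε + i * d)   ≡⟨ cong₂ (λ k l → k * X + l) (sym 2^L≡) (proj₁ (proj₂ off)) ⟩
      2 ^ L * X + (y + i * e)                   ≡⟨ +-assoc (2 ^ L * X) y (i * e) ⟨
      2 ^ L * X + y + i * e                     ∎)
      where
      open ≡-Reasoning
      lem₁ : ∀ i R q d → i * (R * q + d) ≡ R * (i * q) + i * d
      lem₁ = solve-∀
      lem₂ : ∀ R A X ε D → R * (A * X + ε) + D ≡ R * A * X + (R * ε + D)
      lem₂ = solve-∀
    X< : X < 2 ^ (a + 3)
    X< = *-cancelˡ-< (2 ^ a) X (2 ^ (a + 3)) (begin-strict
      2 ^ a * X               ≤⟨ m≤m+n _ ε ⟩
      2 ^ a * X + ε           ≡⟨ iq ⟨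
      i * q                   <⟨ *-mono-< i< q<2^a ⟩
      2 ^ (a + 3) * 2 ^ a     ≡⟨ *-comm (2 ^ (a + 3)) (2 ^ a) ⟩
      2 ^ a * 2 ^ (a + 3)     ∎)
      where open ≤-Reasoning
    z+3< : z + 3 < 2 ^ r
    z+3< = begin-strict
      z + 3                   ≤⟨ +-monoˡ-≤ 3 (m≤m+n z e) ⟩
      X + 3                   <⟨ +-monoˡ-< 3 X< ⟩
      2 ^ (a + 3) + 3         ≤⟨ +-monoʳ-≤ _ (≤-trans (toWitness {a? = 3 ≤? 8} tt) (^-monoʳ-≤ 2 (m≤n+m 3 a))) ⟩
      2 ^ (a + 3) + 2 ^ (a + 3) ≡⟨ lem (2 ^ (a + 3)) ⟩
      2 ^ (1 + (a + 3))       ≡⟨ cong (2 ^_) (+-suc a 3) ⟨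
      2 ^ (a + 4)             ≤⟨ ^-monoʳ-≤ 2 (≤-trans (+-monoʳ-≤ a (n≤1+n 4)) a+5≤r) ⟩
      2 ^ r                   ∎
      where
      open ≤-Reasoning
      lem : ∀ P → P + P ≡ 2 * P
      lem = solve-∀
    τ-8s : ∀ {k} → k ≤ 3 → τ (z + k) ≡ τ s xor τ (ρ + k)
    τ-8s {k} k≤3 = trans (cong τ (+-assoc (8 * s) ρ k))
      (τ-concat 3 s (ρ + k) (≤-trans (s≤s (+-mono-≤ ρ≤2 k≤3)) (toWitness {a? = 6 ≤? 8} tt)))
    cancel : ∀ b x y → (b xor x) xor (b xor y) ≡ x xor y
    cancel false x y = refl
    cancel true false y = not-involutive y
    cancel true true y = refl
    agree : τ X ≡ τ (X + m)
    -- `τ-shift-agree` with y = 0. Since ρ + 3 < 8, the digits of `s` are untouched by adding `e` or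
    -- `d`, so τ s occurs twice and cancels.
    agree = subst (λ k → τ k ≡ τ (k + m)) (cong (_+ X) (*-zeroʳ (2 ^ r)))
      (τ-shift-agree r q m d e 0 z m+e (≤-<-trans (+-monoʳ-≤ z e≤3) z+3<) (≤-<-trans (+-monoʳ-≤ z d≤3) z+3<)
        (begin
          τ (z + e) xor τ (z + d)                             ≡⟨ cong₂ _xor_ (τ-8s e≤3) (τ-8s d≤3) ⟩
          (τ s xor τ (ρ + e)) xor (τ s xor τ (ρ + d))         ≡⟨ cancel (τ s) _ _ ⟩
          τ (ρ + e) xor τ (ρ + d)                             ≡⟨ sign ⟩
          τ q                                                 ≡⟨ cong τ (+-identityʳ q) ⟨
          τ (q + 0)                                           ∎))
      where open ≡-Reasoning
    a≤c : a ≤ c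
    a≤c = double-cancel-≤ (≤-trans (+-monoˡ-≤ a (≤-trans (m≤m+n a 5) a+5≤r)) (≤-trans (≤-reflexive r+a) L≤2c))
    i≤ : i ≤ 2 ^ (c + 10)
    i≤ = ≤-trans (<⇒≤ i<) (^-monoʳ-≤ 2 (+-mono-≤ a≤c (toWitness {a? = 3 ≤? 10} tt)))

  collision : (∃ λ z → z ≤ 11 × τ (z + e) xor τ (z + d) ≡ τ (suc z + e) xor τ (suc z + d)) →
    (∀ b → ∃ λ ρ → ρ ≤ 2 × τ (ρ + e) xor τ (ρ + d) ≡ b) → Collision c L m
  collision pair choose with a + 5 ≤? r
  ... | yes le = collision-large-r choose le
  ... | no ≰ = collision-small-r pair (≤-pred (subst (suc r ≤_) (+-suc a 4) (≰⇒> ≰)))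

-- All odd lengths

-- Two neighbouring low parts with the same prescribed sign `b`, each fitting into five binary
-- digits.
SignedPair : ℕ → ℕ → Bool → Set
SignedPair d e b = ∃ λ z → suc z + e < 32 × suc z + d < 32 ×
  τ (z + e) xor τ (z + d) ≡ b × τ (suc z + e) xor τ (suc z + d) ≡ b

-- `Q` may be even, so `odd-both-signs` does not apply. Instead y = 0 is fixed, the required sign is
-- τ Q, and the low part has to realise either sign by itself.
collision-mod-32 : ∀ c L m Q d e → m + e ≡ 32 * Q + d → 0 < m → m < 2 ^ L → 2 ^ L ≤ 4 * m →
  (∀ b → SignedPair d e b) → Collision c L m
collision-mod-32 c L m Q d e m+e 0<m m<P P≤4m choose = from-pair (choose (τ (Q + 0)))
  where
  bound : ∀ {X} → X < 32 → suc (4 * X) ≤ 2 ^ (c + 10)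
  bound {X} X<32 = begin
    suc (4 * X)         ≤⟨ +-monoʳ-≤ 1 (*-monoʳ-≤ 4 (<⇒≤ X<32)) ⟩
    129                 ≤⟨ toWitness {a? = 129 ≤? 2 ^ 10} tt ⟩
    2 ^ 10              ≤⟨ ^-monoʳ-≤ 2 (m≤n+m 10 c) ⟩
    2 ^ (c + 10)        ∎
    where open ≤-Reasoning
  from-pair : SignedPair d e (τ (Q + 0)) → Collision c L m
  from-pair (z , ze< , zd< , sign₀ , sign₁) =
    proj₁ near , ≤-trans (proj₁ (proj₂ near)) (bound (<⇒≤ ze<)) , proj₂ (proj₂ near)
    where
    near : ∃ λ i → i ≤ suc (4 * (z + e)) × block m i ≡ block m (i + 2 ^ L)
    near = two-cell-collision-near L m (z + e) 0<m m<P P≤4m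
      (τ-shift-agree 5 Q m d e 0 z m+e (<⇒≤ ze<) (<⇒≤ zd<) sign₀)
      (τ-shift-agree 5 Q m d e 0 (suc z) m+e ze< zd< sign₁)

signed-pair : ∀ {e d b} z {_ : True (suc z + e <? 32)} {_ : True (suc z + d <? 32)} →
  τ (z + e) xor τ (z + d) ≡ b → τ (suc z + e) xor τ (suc z + d) ≡ b → SignedPair d e b
signed-pair z {ze} {zd} eq₀ eq₁ = z , toWitness ze , toWitness zd , eq₀ , eq₁

collision-odd : ∀ c L r → r ≢ 0 → r ≢ 1 → (1 + 2 * r) + 3 < 2 ^ L → 2 ^ L ≤ 4 * (1 + 2 * r) → L ≤ c + c →
  Collision c L (1 + 2 * r)
collision-odd c L r r≢0 r≢1 m+3< P≤4m L≤2c with r divMod 8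
... | result k ρ eq = go ρ eq
  where
  m : ℕ
  m = 1 + 2 * r

  m<P : m < 2 ^ L
  m<P = ≤-<-trans (m≤m+n m 3) m+3<

  -- The remaining powers of two in `n` are moved into the exponent, so that r = 4 + s and the
  -- cofactor is odd.
  near : ∀ d e {_ : True (d ≤? 3)} {_ : True (e ≤? 3)} → e ≡ 0 ⊎ d ≡ 0 → ∀ n → m + e ≡ 16 * n + d → 0 < n →
    (∃ λ z → z ≤ 11 × τ (z + e) xor τ (z + d) ≡ τ (suc z + e) xor τ (suc z + d)) →
    (∀ b → ∃ λ ρ → ρ ≤ 2 × τ (ρ + e) xor τ (ρ + d) ≡ b) → Collision c L m
  near d e {d≤3} {e≤3} or n m+e 0<n with dyadic n 0<n
  ... | s , p , refl = NearDyadic.collision c L m (4 + s) p d e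
        (trans m+e (cong (_+ d) 16n≡))
        (m≤m+n 4 s) (toWitness d≤3) (toWitness e≤3) or (s≤s z≤n) m+3< P≤4m L≤2c
    where
    16n≡ : 16 * (2 ^ s * (1 + 2 * p)) ≡ 2 ^ (4 + s) * (1 + 2 * p)
    16n≡ = trans (sym (*-assoc 16 (2 ^ s) (1 + 2 * p))) (cong (_* (1 + 2 * p)) (sym (^-distribˡ-+-* 2 4 s)))

  -- For even `k`, m lies `d` above a multiple of 32; for odd `k` it is measured down from the next
  -- one. In the four uses `d` and `e` lie in {5, 7, 9, 11}, and swapping their roles does not
  -- change the signs, so the same four tables recur.
  far : ∀ ρ d e → (∀ h → 1 + 2 * (ρ + 2 * h * 8) + 0 ≡ 32 * h + d) →
    (∀ h → 1 + 2 * (ρ + (1 + 2 * h) * 8) + e ≡ 32 * (1 + h) + 0) →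
    r ≡ ρ + k * 8 → (∀ b → SignedPair d 0 b) → (∀ b → SignedPair 0 e b) → Collision c L m
  far ρ d e even odd r≡ pairs₀ pairs₁ = split (halve k)
    where
    split : (∃ λ h → k ≡ 2 * h ⊎ k ≡ 1 + 2 * h) → Collision c L m
    split (h , inj₁ k≡) = collision-mod-32 c L m h d 0
      (trans (cong (λ r → 1 + 2 * r + 0) (trans r≡ (cong (λ k → ρ + k * 8) k≡))) (even h)) (s≤s z≤n) m<P P≤4m pairs₀
    split (h , inj₂ k≡) = collision-mod-32 c L m (1 + h) 0 e
      (trans (cong (λ r → 1 + 2 * r + e) (trans r≡ (cong (λ k → ρ + k * 8) k≡))) (odd h)) (s≤s z≤n) m<P P≤4m pairs₁

  0<k : ∀ ρ → r ≢ ρ → r ≡ ρ + k * 8 → 0 < k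
  0<k ρ r≢ρ r≡ = n≢0⇒n>0 λ k≡0 → r≢ρ (trans r≡ (trans (cong (λ k → ρ + k * 8) k≡0) (+-identityʳ ρ)))

  -- m = 16k + 2ρ + 1, so ρ = 0, 1, 6, 7 are the residues 1, 3, -3, -1 modulo 16.
  go : (ρ : Fin 8) → r ≡ toℕ ρ + k * 8 → Collision c L m
  go zero r≡ = near 1 0 (inj₁ refl) k (trans (cong (λ r → 1 + 2 * r + 0) r≡) (lem k)) (0<k 0 r≢0 r≡)
    -- τ z xor τ (z + 1) is true, false, true, true at z = 0, 1, 2, 3.
    (2 , s≤s (s≤s z≤n) , refl) λ where
      false → 1 , s≤s z≤n , refl
      true  → 0 , z≤n , refl
    where
    lem : ∀ k → 1 + 2 * (k * 8) + 0 ≡ 16 * k + 1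
    lem = solve-∀
  go (suc zero) r≡ = near 3 0 (inj₁ refl) k (trans (cong (λ r → 1 + 2 * r + 0) r≡) (lem k)) (0<k 1 r≢1 r≡)
    -- τ z xor τ (z + 3) is false, false, true at z = 0, 1, 2.
    (0 , z≤n , refl) λ where
      false → 0 , z≤n , refl
      true  → 2 , ≤-refl , refl
    where
    lem : ∀ k → 1 + 2 * (1 + k * 8) + 0 ≡ 16 * k + 3
    lem = solve-∀
  go (suc (suc zero)) r≡ = far 2 5 11 even odd r≡
    (λ where false → signed-pair 10 refl refl
             true  → signed-pair 3 refl refl)
    (λ where false → signed-pair 8 refl refl
             true  → signed-pair 0 refl refl)
    where
    even : ∀ h → 1 + 2 * (2 + 2 * h * 8) + 0 ≡ 32 * h + 5
    even = solve-∀
    odd : ∀ h → 1 + 2 * (2 + (1 + 2 * h) * 8) + 11 ≡ 32 * (1 + h) + 0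
    odd = solve-∀
  go (suc (suc (suc zero))) r≡ = far 3 7 9 even odd r≡
    (λ where false → signed-pair 3 refl refl
             true  → signed-pair 8 refl refl)
    (λ where false → signed-pair 2 refl refl
             true  → signed-pair 10 refl refl)
    where
    even : ∀ h → 1 + 2 * (3 + 2 * h * 8) + 0 ≡ 32 * h + 7
    even = solve-∀
    odd : ∀ h → 1 + 2 * (3 + (1 + 2 * h) * 8) + 9 ≡ 32 * (1 + h) + 0
    odd = solve-∀
  go (suc (suc (suc (suc zero)))) r≡ = far 4 9 7 even odd r≡
    (λ where false → signed-pair 2 refl refl
             true  → signed-pair 10 refl refl)
    (λ where false → signed-pair 3 refl refl
             true  → signed-pair 8 refl refl)
    where
    even : ∀ h → 1 + 2 * (4 + 2 * h * 8) + 0 ≡ 32 * h + 9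
    even = solve-∀
    odd : ∀ h → 1 + 2 * (4 + (1 + 2 * h) * 8) + 7 ≡ 32 * (1 + h) + 0
    odd = solve-∀
  go (suc (suc (suc (suc (suc zero))))) r≡ = far 5 11 5 even odd r≡
    (λ where false → signed-pair 8 refl refl
             true  → signed-pair 0 refl refl)
    (λ where false → signed-pair 10 refl refl
             true  → signed-pair 3 refl refl)
    where
    even : ∀ h → 1 + 2 * (5 + 2 * h * 8) + 0 ≡ 32 * h + 11
    even = solve-∀
    odd : ∀ h → 1 + 2 * (5 + (1 + 2 * h) * 8) + 5 ≡ 32 * (1 + h) + 0
    odd = solve-∀
  go (suc (suc (suc (suc (suc (suc zero)))))) r≡ = near 0 3 (inj₂ refl) (1 + k)
    (trans (cong (λ r → 1 + 2 * r + 3) r≡) (lem k)) (s≤s z≤n)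
    (0 , z≤n , refl) λ where
      false → 0 , z≤n , refl
      true  → 2 , ≤-refl , refl
    where
    lem : ∀ k → 1 + 2 * (6 + k * 8) + 3 ≡ 16 * (1 + k) + 0
    lem = solve-∀
  go (suc (suc (suc (suc (suc (suc (suc zero))))))) r≡ = near 0 1 (inj₂ refl) (1 + k)
    (trans (cong (λ r → 1 + 2 * r + 1) r≡) (lem k)) (s≤s z≤n)
    (2 , s≤s (s≤s z≤n) , refl) λ where
      false → 1 , s≤s z≤n , refl
      true  → 0 , z≤n , refl
    where
    lem : ∀ k → 1 + 2 * (7 + k * 8) + 1 ≡ 16 * (1 + k) + 0
    lem = solve-∀

-- The bounds on γ

Repetition : ℕ → ℕ → Set
Repetition m B = ∃ λ i → ∃ λ j → i < j × j ≤ B × block m i ≡ block m j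

2^10≤bound : ∀ c L → 2 ^ 10 ≤ 2 ^ L + 2 ^ (c + 10)
2^10≤bound c L = ≤-trans (^-monoʳ-≤ 2 (m≤n+m 10 c)) (m≤n+m _ (2 ^ L))

repetition-below : ∀ c L r → (1 + 2 * r) + 3 < 2 ^ L → L ≤ c + c → Repetition (1 + 2 * r) (2 ^ L + 2 ^ (c + 10))
-- Lengths 1 and 3 are read off the prefixes 0,1,1,0 and 011,010,011.
repetition-below c L 0 _ _ =
  0 , 3 , s≤s z≤n , ≤-trans (toWitness {a? = 3 ≤? 2 ^ 10} tt) (2^10≤bound c L) , refl
repetition-below c L 1 _ _ =
  0 , 2 , s≤s z≤n , ≤-trans (toWitness {a? = 2 ≤? 2 ^ 10} tt) (2^10≤bound c L) , refl
repetition-below c zero (suc (suc r)) (s≤s ()) _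
repetition-below c (suc L) r@(suc (suc r′)) m+3< L≤2c with 2 ^ suc L ≤? 4 * (1 + 2 * r)
... | yes P≤4m = from-collision (collision-odd c (suc L) r (λ ()) (λ ()) m+3< P≤4m L≤2c)
  where
  from-collision : Collision c (suc L) (1 + 2 * r) → Repetition (1 + 2 * r) (2 ^ suc L + 2 ^ (c + 10))
  from-collision (i , i≤ , eq) = i , i + 2 ^ suc L , m<m+n i (m^n>0 2 (suc L)) ,
    ≤-trans (+-monoˡ-≤ _ i≤) (≤-reflexive (+-comm (2 ^ (c + 10)) (2 ^ suc L))) , eq
... | no P≰4m = weaken (repetition-below c L r smaller (≤-trans (n≤1+n L) L≤2c))
  where
  smaller : (1 + 2 * r) + 3 < 2 ^ L
  smaller = *-cancelˡ-< 2 _ _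
    -- 2(m + 3) ≤ 4m because m ≥ 5, and 4m < 2^(1 + L) in this case.
    (≤-<-trans (subst₂ _≤_ (lem₁ r′) (lem₂ r′) (+-monoʳ-≤ (16 + 4 * r′) z≤n)) (≰⇒> P≰4m))
    where
    lem₁ : ∀ r → 16 + 4 * r + 0 ≡ 2 * (1 + 2 * (2 + r) + 3)
    lem₁ = solve-∀
    lem₂ : ∀ r → 16 + 4 * r + (4 + 4 * r) ≡ 4 * (1 + 2 * (2 + r))
    lem₂ = solve-∀
  weaken : Repetition (1 + 2 * r) (2 ^ L + 2 ^ (c + 10)) → Repetition (1 + 2 * r) (2 ^ suc L + 2 ^ (c + 10))
  weaken (i , j , i<j , j≤ , eq) = i , j , i<j , ≤-trans j≤ (+-monoˡ-≤ _ (m≤m+n (2 ^ L) _)) , eq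

threshold : ℕ → ℕ
threshold L = 2 ^ L + 2 ^ (⌈ L /2⌉ + 10)

≤⌈/2⌉+⌈/2⌉ : ∀ n → n ≤ ⌈ n /2⌉ + ⌈ n /2⌉
≤⌈/2⌉+⌈/2⌉ n = ≤-trans (≤-reflexive (sym (⌊n/2⌋+⌈n/2⌉≡n n))) (+-monoˡ-≤ ⌈ n /2⌉ (⌊n/2⌋≤⌈n/2⌉ n))

anti-power-lower-bound : ∀ L k m → threshold L < k → InF k m → 2 ^ L ≤ m + 3
anti-power-lower-bound L k .(1 + 2 * r) T<k ((r , refl) , anti) = ≮⇒≥ λ m+3< →
  contra (repetition-below ⌈ L /2⌉ L r m+3< (≤⌈/2⌉+⌈/2⌉ L))
  where
  contra : ¬ Repetition (1 + 2 * r) (threshold L)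
  contra (i , j , i<j , j≤ , eq) = anti i j (<-trans i<j j<k) j<k (<⇒≢ i<j) eq
    where
    j<k : j < k
    j<k = ≤-<-trans j≤ T<k

-- Odd anti-power lengths exist, hence so does γ

≢→anti-power : ∀ k m → (∀ i j → i < j → j < k → block m i ≢ block m j) → PrefixAntiPower k m
≢→anti-power k m distinct i j i<k j<k i≢j with <-cmp i j
... | tri< i<j _ _ = distinct i j i<j j<k
... | tri≈ _ i≡j _ = contradiction i≡j i≢j
... | tri> _ _ j<i = λ eq → distinct j i j<i i<k (sym eq)

-- Where blocks i < j agree, τ (n + (j ∸ i)) xor τ n is constant for i ≤ n and n + (j ∸ i) < 2 ^ (2 + M);
-- the points n = 2 ^ M ∸ (j ∸ i) and n = 2 ^ (1 + M) ∸ (j ∸ i) violate this.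
anti-power-1+2^ : ∀ k M → k ≤ 2 ^ M → PrefixAntiPower k (1 + 2 ^ (2 + M))
anti-power-1+2^ k M k≤ = ≢→anti-power k m distinct
  where
  P m : ℕ
  P = 2 ^ M
  m = 1 + 2 ^ (2 + M)

  -- n + δ goes up to 2P, which must still be an offset inside a cell; hence cells of length 4P.
  2P<4P : 2 * P < 2 ^ (2 + M)
  2P<4P = *-monoʳ-< 2 (m<m+n P (≤-trans (m^n>0 2 M) (m≤m+n P 0)))

  distinct : ∀ i j → i < j → j < k → block m i ≢ block m j
  distinct i j i<j j<k eq = contradictory (τ i) (τ j) (τ w) at-w at-P+w
    where
    δ w : ℕ
    δ = j ∸ i
    w = P ∸ δ

    i+δ : i + δ ≡ j
    i+δ = m+[n∸m]≡n (<⇒≤ i<j)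

    j≤P : j ≤ P
    j≤P = ≤-trans (<⇒≤ j<k) k≤

    w+δ : w + δ ≡ P
    w+δ = m∸n+n≡m (≤-trans (m∸n≤m j i) j≤P)

    i≤w : i ≤ w
    i≤w = +-cancelʳ-≤ δ i w (subst₂ _≤_ (sym i+δ) (sym w+δ) j≤P)

    w<P : w < P
    w<P = subst (w <_) w+δ (m<m+n w (m<n⇒0<n∸m i<j))

    -- Since m is one more than the cell length, block `i` starts at offset `i` of cell `i`; its
    -- entry n - i therefore sits at offset `n`.
    agree : ∀ n → i ≤ n → n + δ < 2 ^ (2 + M) → τ i xor τ n ≡ τ j xor τ (n + δ)
    agree n i≤n n+δ< = begin
      τ i xor τ n                         ≡⟨ τ-concat (2 + M) i n n< ⟨
      τ (2 ^ (2 + M) * i + n)             ≡⟨ cong (λ k → τ (2 ^ (2 + M) * i + k)) (m+[n∸m]≡n i≤n) ⟨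
      τ (2 ^ (2 + M) * i + (i + (n ∸ i))) ≡⟨ cong τ (lem (2 ^ (2 + M)) i (n ∸ i)) ⟨
      τ (i * m + (n ∸ i))                 ≡⟨ block-pointwise m i j eq (≤-<-trans (m∸n≤m n i) (<-trans n< ≤-refl)) ⟩
      τ (j * m + (n ∸ i))                 ≡⟨ cong τ (lem (2 ^ (2 + M)) j (n ∸ i)) ⟩
      τ (2 ^ (2 + M) * j + (j + (n ∸ i))) ≡⟨ cong (λ k → τ (2 ^ (2 + M) * j + k)) j+[n∸i] ⟩
      τ (2 ^ (2 + M) * j + (n + δ))       ≡⟨ τ-concat (2 + M) j (n + δ) n+δ< ⟩
      τ j xor τ (n + δ)                   ∎
      where
      open ≡-Reasoning
      n< : n < 2 ^ (2 + M)
      n< = ≤-<-trans (m≤m+n n δ) n+δ<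
      lem : ∀ Q i p → i * (1 + Q) + p ≡ Q * i + (i + p)
      lem = solve-∀
      lem₂ : ∀ i δ p → i + δ + p ≡ i + p + δ
      lem₂ = solve-∀
      j+[n∸i] : j + (n ∸ i) ≡ n + δ
      j+[n∸i] = begin
        j + (n ∸ i)       ≡⟨ cong (_+ (n ∸ i)) i+δ ⟨
        i + δ + (n ∸ i)   ≡⟨ lem₂ i δ (n ∸ i) ⟩
        i + (n ∸ i) + δ   ≡⟨ cong (_+ δ) (m+[n∸m]≡n i≤n) ⟩
        n + δ             ∎

    τ-P+ : ∀ c → c < P → τ (P + c) ≡ not (τ c)
    τ-P+ c c<P = trans (cong (λ k → τ (k + c)) (sym (*-identityʳ P))) (τ-concat M 1 c c<P)

    τ-P : τ P ≡ true
    τ-P = trans (cong τ (sym (+-identityʳ P))) (τ-P+ 0 (m^n>0 2 M))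

    -- Shifting w and P + w by δ gives P and 2P, where τ agrees, while τ w and τ (P + w) are
    -- opposite.
    at-w : τ i xor τ w ≡ τ j xor true
    at-w = trans (agree w i≤w (subst (_< 2 ^ (2 + M)) (sym w+δ) (≤-<-trans (m≤m+n P _) 2P<4P)))
      (cong (τ j xor_) (trans (cong τ w+δ) τ-P))

    P+w+δ : P + w + δ ≡ 2 * P
    P+w+δ = trans (+-assoc P w δ) (trans (cong (P +_) w+δ) (cong (P +_) (sym (+-identityʳ P))))

    at-P+w : τ i xor not (τ w) ≡ τ j xor true
    at-P+w = trans (cong (τ i xor_) (sym (τ-P+ w w<P)))
      (trans (agree (P + w) (≤-trans i≤w (m≤n+m w P)) (subst (_< 2 ^ (2 + M)) (sym P+w+δ) 2P<4P))
        (cong (τ j xor_) (trans (cong τ P+w+δ) (trans (τ-double P) τ-P))))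

    contradictory : ∀ a b c → a xor c ≡ b xor true → a xor not c ≡ b xor true → ⊥
    contradictory a b c eq₁ eq₂ = not-¬ refl (trans (trans eq₁ (sym eq₂)) (sym (not-distribʳ-xor a c)))

least : ∀ {P : ℕ → Set} → (∀ n → Dec (P n)) → ∀ n → P n → ∃ λ m → P m × (∀ {j} → P j → m ≤ j)
least {P} P? n Pn = [ id , (λ none → contradiction Pn (none ≤-refl)) ]′ (search (suc n))
  where
  search : ∀ b → (∃ λ m → P m × (∀ {j} → P j → m ≤ j)) ⊎ (∀ {j} → j < b → ¬ P j)
  search zero = inj₂ λ ()
  search (suc b) with search b | P? b
  ... | inj₁ found | _      = inj₁ found
  ... | inj₂ none  | yes Pb = inj₁ (b , Pb , λ Pj → ≮⇒≥ λ j<b → none j<b Pj)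
  ... | inj₂ none  | no ¬Pb = inj₂ λ j<1+b Pj →
          [ (λ j<b → none j<b Pj) , (λ { refl → ¬Pb Pj }) ]′ (m≤n⇒m<n∨m≡n (≤-pred j<1+b))

anti-power? : ∀ k m → Dec (PrefixAntiPower k m)
anti-power? k m = map′ (λ distinct i j i<k j<k → distinct {i} i<k {j} j<k) (λ anti {i} i<k {j} j<k → anti i j i<k j<k)
  (allUpTo? (λ i → allUpTo? (λ j → ¬? (i ≟ j) →-dec ¬? (List-≡-dec _≟_ (block m i) (block m j))) k) k)

n<2^n : ∀ n → n < 2 ^ n
n<2^n zero    = s≤s z≤n
n<2^n (suc n) = ≤-trans (+-mono-≤ (m^n>0 2 n) (n<2^n n)) (+-monoʳ-≤ (2 ^ n) (m≤m+n (2 ^ n) 0))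

-- The search runs over r with m = 1 + 2r; the anti-power length 1 + 2^(2 + k), available because k
-- ≤ 2^k, shows that it ends.
γ-exists : ∀ k → ∃ λ g → IsGamma k g
γ-exists k with least (λ r → anti-power? k (1 + 2 * r)) (2 ^ suc k) (anti-power-1+2^ k k (<⇒≤ (n<2^n k)))
... | r , anti , minimal = 1 + 2 * r , ((r , refl) , anti) ,
  λ { m ((r′ , refl) , anti′) → +-monoʳ-≤ 1 (*-monoʳ-≤ 2 (minimal {r′} anti′)) }

-- From dyadic thresholds to the limits

bracket : ∀ (f : ℕ → ℕ) → (∀ n → n ≤ f n) → ∀ n₀ k → f n₀ < k → ∃ λ n → n₀ ≤ n × f n < k × k ≤ f (suc n)
-- Descend from n₀ + k, where `f` is already at least `k`, to the first index at which `f` drops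
-- below `k`.
bracket f n≤fn n₀ k fn₀<k = go k (≤-trans (m≤n+m k n₀) (n≤fn (n₀ + k)))
  where
  go : ∀ b → k ≤ f (n₀ + b) → ∃ λ n → n₀ ≤ n × f n < k × k ≤ f (suc n)
  go zero k≤ = contradiction (subst (λ n → k ≤ f n) (+-identityʳ n₀) k≤) (<⇒≱ fn₀<k)
  go (suc b) k≤ with f (n₀ + b) <? k
  ... | yes f<k = n₀ + b , m≤m+n n₀ b , f<k , subst (λ n → k ≤ f n) (+-suc n₀ b) k≤
  ... | no f≮k = go b (≮⇒≥ f≮k)

L≤threshold : ∀ L → L ≤ threshold L
L≤threshold L = ≤-trans (<⇒≤ (n<2^n L)) (m≤m+n (2 ^ L) _)

≤⌊/2⌋ : ∀ {n L} → n + n ≤ L → n ≤ ⌊ L /2⌋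
≤⌊/2⌋ {n} {L} le = ≤-trans (≤-reflexive (n≡⌊n+n/2⌋ n)) (⌊n/2⌋-mono le)

-- The factor n + 1 costs at most 2^n, and x + 2^(b + 10) at most one doubling of 2^(b + 10), whence
-- the 11. With `b` about L/2 this asks for n + 11 to be at most about L/2.
scaled-error : ∀ n x b L → x ≤ 6 → n + (b + 11) ≤ L → suc n * (x + 2 ^ (b + 10)) ≤ 2 ^ L
scaled-error n x b L x≤6 exp≤ = begin
  suc n * (x + 2 ^ (b + 10))             ≤⟨ *-mono-≤ (n<2^n n) (+-monoˡ-≤ (2 ^ (b + 10)) x≤E) ⟩
  2 ^ n * (2 ^ (b + 10) + 2 ^ (b + 10))  ≡⟨ cong (2 ^ n *_) (cong (2 ^ (b + 10) +_) (+-identityʳ (2 ^ (b + 10)))) ⟨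
  2 ^ n * 2 ^ suc (b + 10)               ≡⟨ cong (λ e → 2 ^ n * 2 ^ e) (+-suc b 10) ⟨
  2 ^ n * 2 ^ (b + 11)                   ≡⟨ ^-distribˡ-+-* 2 n (b + 11) ⟨
  2 ^ (n + (b + 11))                     ≤⟨ ^-monoʳ-≤ 2 exp≤ ⟩
  2 ^ L                                  ∎
  where
  open ≤-Reasoning
  x≤E : x ≤ 2 ^ (b + 10)
  x≤E = ≤-trans x≤6 (≤-trans (toWitness {a? = 6 ≤? 2 ^ 10} tt) (^-monoʳ-≤ 2 (m≤n+m 10 b)))

-- This is g/k ≥ 1/2 - 1/(n + 1) with denominators cleared. The loss of a factor 2 comes from k
-- reaching up to about 2^(L + 1) while g is only known to be about 2^L.
liminf-bound : ∀ n L k g → (n + 11) + (n + 11) ≤ L → threshold L < k → k ≤ threshold (suc L) → 2 ^ L ≤ g + 3 →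
  suc n * k ≤ 2 * suc n * g + 2 * k
liminf-bound n L k g 2[n+11]≤L T<k k≤T 2^L≤ = begin
  suc n * k                                 ≤⟨ *-monoʳ-≤ (suc n) k≤T ⟩
  suc n * (2 * 2 ^ L + E)                   ≤⟨ *-monoʳ-≤ (suc n) (+-monoˡ-≤ E (*-monoʳ-≤ 2 2^L≤)) ⟩
  suc n * (2 * (g + 3) + E)                 ≡⟨ lem (suc n) g E ⟩
  2 * suc n * g + suc n * (6 + E)           ≤⟨ +-monoʳ-≤ (2 * suc n * g) (scaled-error n 6 (suc h) (suc L) ≤-refl exponent) ⟩
  2 * suc n * g + 2 * 2 ^ L                 ≤⟨ +-monoʳ-≤ (2 * suc n * g) (*-monoʳ-≤ 2 2^L≤k) ⟩
  2 * suc n * g + 2 * k                     ∎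
  where
  open ≤-Reasoning
  h E : ℕ
  h = ⌊ L /2⌋
  -- `⌈ suc L /2⌉` unfolds to `suc ⌊ L /2⌋`, so this is the error term of `threshold (suc L)`.
  E = 2 ^ (suc h + 10)
  2^L≤k : 2 ^ L ≤ k
  2^L≤k = ≤-trans (m≤m+n (2 ^ L) _) (<⇒≤ T<k)
  lem : ∀ N g E → N * (2 * (g + 3) + E) ≡ 2 * N * g + N * (6 + E)
  lem = solve-∀
  exponent : n + (suc h + 11) ≤ suc L
  exponent = begin
    n + (suc h + 11)      ≡⟨ lem₂ n h ⟩
    suc ((n + 11) + h)    ≤⟨ +-monoʳ-≤ 1 (+-mono-≤ (≤⌊/2⌋ 2[n+11]≤L) (⌊n/2⌋≤⌈n/2⌉ L)) ⟩
    suc (h + ⌈ L /2⌉)     ≡⟨ cong suc (⌊n/2⌋+⌈n/2⌉≡n L) ⟩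
    suc L                 ∎
    where
    lem₂ : ∀ n h → n + ((1 + h) + 11) ≡ 1 + ((n + 11) + h)
    lem₂ = solve-∀

-- This is g/k ≥ 1 - 1/(n + 1) for k = threshold L + 1, the least k to which the bound g ≥ 2^L - 3
-- applies. The error 4 is this 1 plus the 3.
limsup-bound : ∀ n L g → (n + 11) + (n + 11) ≤ L → 2 ^ L ≤ g + 3 →
  suc n * suc (threshold L) ≤ suc n * g + suc (threshold L)
limsup-bound n L g 2[n+11]≤L 2^L≤ = begin
  suc n * suc (2 ^ L + E)                   ≤⟨ *-monoʳ-≤ (suc n) (+-monoʳ-≤ 1 (+-monoˡ-≤ E 2^L≤)) ⟩
  suc n * suc (g + 3 + E)                   ≡⟨ lem (suc n) g E ⟩
  suc n * g + suc n * (4 + E)               ≤⟨ +-monoʳ-≤ (suc n * g) (scaled-error n 4 ⌈ L /2⌉ L (m≤m+n 4 2) exponent) ⟩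
  suc n * g + 2 ^ L                         ≤⟨ +-monoʳ-≤ (suc n * g) (≤-trans (m≤m+n (2 ^ L) E) (n≤1+n _)) ⟩
  suc n * g + suc (2 ^ L + E)               ∎
  where
  open ≤-Reasoning
  E : ℕ
  E = 2 ^ (⌈ L /2⌉ + 10)
  lem : ∀ N g E → N * (1 + (g + 3 + E)) ≡ N * g + N * (4 + E)
  lem = solve-∀
  exponent : n + (⌈ L /2⌉ + 11) ≤ L
  exponent = begin
    n + (⌈ L /2⌉ + 11)    ≡⟨ lem₂ n ⌈ L /2⌉ ⟩
    (n + 11) + ⌈ L /2⌉    ≤⟨ +-monoˡ-≤ ⌈ L /2⌉ (≤⌊/2⌋ 2[n+11]≤L) ⟩
    ⌊ L /2⌋ + ⌈ L /2⌉     ≡⟨ ⌊n/2⌋+⌈n/2⌉≡n L ⟩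
    L                     ∎
    where
    lem₂ : ∀ n c → n + (c + 11) ≡ (n + 11) + c
    lem₂ = solve-∀

theorem3 : ((n : ℕ) → Σ ℕ λ K → (k : ℕ) → k ≥ K →
    Σ ℕ λ g → IsGamma k g × (suc n * k ≤ 2 * suc n * g + 2 * k))
    ×
    ((n K : ℕ) → Σ ℕ λ k → k ≥ K ×
    Σ ℕ λ g → IsGamma k g × (suc n * k ≤ suc n * g + k))
theorem3 = liminf-part , limsup-part
  where
  liminf-part : (n : ℕ) → Σ ℕ λ K → (k : ℕ) → k ≥ K →
    Σ ℕ λ g → IsGamma k g × (suc n * k ≤ 2 * suc n * g + 2 * k)
  liminf-part n = suc (threshold L₀) , λ k k≥K →
    let L , L₀≤L , T<k , k≤T = bracket threshold L≤threshold L₀ k k≥K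
        g , γ = γ-exists k
    in g , γ , liminf-bound n L k g L₀≤L T<k k≤T (anti-power-lower-bound L k g T<k (proj₁ γ))
    where
    L₀ : ℕ
    L₀ = (n + 11) + (n + 11)

  limsup-part : (n K : ℕ) → Σ ℕ λ k → k ≥ K ×
    Σ ℕ λ g → IsGamma k g × (suc n * k ≤ suc n * g + k)
  limsup-part n K =
    let g , γ = γ-exists k
    in k , K≤k , g , γ , limsup-bound n L g (m≤m+n _ K) (anti-power-lower-bound L k g ≤-refl (proj₁ γ))
    where
    L k : ℕ
    -- The summand `K` secures k ≥ K, by L ≤ threshold L.
    L = (n + 11) + (n + 11) + K
    k = suc (threshold L)
    K≤k : K ≤ k
    K≤k = ≤-trans (m≤n+m K ((n + 11) + (n + 11))) (≤-trans (L≤threshold L) (n≤1+n _))
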